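{- Let $\mathcal{L}_{\rm GM}$ be the golden mean language and let ${\rm S}:\mathcal{L}_{\rm GM}\to\mathbb{N}$ be a homomorphism. Write ${\rm S}_a={\rm S}(a)$, ${\rm S}_b={\rm S}(b)$, and suppose $\gcd({\rm S}_a,{\rm S}_b)=1$, ${\rm S}_a>1$ and ${\rm S}_b>1$. Then $\mathbb{N}\setminus {\rm S}(\mathcal{L}_{\rm GM})$ is finite and nonempty, and $$\max\,\big(\mathbb{N}\setminus {\rm S}(\mathcal{L}_{\rm GM})\big)={\rm S}_a({\rm S}_a-3)+{\rm S}_b({\rm S}_a-1).$$
   Context: $\mathbb{N}=\{1,2,3,\dots\}$. The golden mean language $\mathcal{L}_{\rm GM}$ is the set of all nonempty finite words over the alphabet $\{a,b\}$ in which $bb$ does not occur as a subword (factor). A homomorphism ${\rm S}:\mathcal{L}\to\mathbb{N}$ of a language $\mathcal{L}$ over an alphabet is a map with ${\rm S}(w_1w_2\cdots w_n)={\rm S}(w_1)+\cdots+{\rm S}(w_n)$ for every word $w_1\cdots w_n\in\mathcal{L}$ (equivalently ${\rm S}(vw)={\rm S}(v)+{\rm S}(w)$), so it is determined by the positive integers ${\rm S}(a),{\rm S}(b)$. -}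

module Defs where

open import Data.Irrelevant using () renaming ([_] to irr)
open import Data.List using ([]; _∷_; map)
open import Data.List.Membership.Propositional using () renaming (_∈_ to _∈ₗ_)
open import Data.List.NonEmpty using (List⁺; toList; [_])
open import Data.List.Relation.Binary.Infix.Heterogeneous using (Infix; here; there)
open import Data.List.Relation.Binary.Prefix.Heterogeneous using ([]; _∷_)
open import Data.Nat using (ℕ; _≤_; _<_)
open import Data.Nat.ListAction using (sum)
open import Data.Product using (∃-syntax; _×_)
open import Data.Refinement using (Refinement-syntax; value; _,_)
open import Function.Bundles using (_⇔_)
open import Level using (0ℓ)
open import Relation.Binary.PropositionalEquality using (_≡_)
open import Relation.Nullary using (¬_)
open import Relation.Unary using (Pred; _∈_)

ℕ⁺ : Pred ℕ 0ℓ
ℕ⁺ n = 0 < n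

data Letter : Set where
  a b : Letter

GoldenMean : Pred (List⁺ Letter) 0ℓ
GoldenMean w = ¬ Infix _≡_ (b ∷ b ∷ []) (toList w)

-- Membership is proof-irrelevant, so that a map out of this type is a
-- function of the underlying word only.
𝓛-GM : Set
𝓛-GM = [ w ∈ List⁺ Letter ∣ GoldenMean w ]

letter∈GM : ∀ x → GoldenMean [ x ]
letter∈GM x (here (_ ∷ ()))
letter∈GM x (there (here ()))

letter : Letter → 𝓛-GM
letter x = [ x ] , irr (letter∈GM x)

record Homomorphism : Set where
  field
    ⟦_⟧      : 𝓛-GM → ℕ
    positive : ∀ w → ⟦ w ⟧ ∈ ℕ⁺
    homo     : ∀ w → ⟦ w ⟧ ≡ sum (map (λ x → ⟦ letter x ⟧) (toList (value w)))

Image : Homomorphism → Pred ℕ 0ℓ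
Image S n = ∃[ w ] Homomorphism.⟦_⟧ S w ≡ n

Finite : Pred ℕ 0ℓ → Set
Finite P = ∃[ ns ] (∀ n → n ∈ₗ ns ⇔ n ∈ P)

Nonempty : Pred ℕ 0ℓ → Set
Nonempty P = ∃[ n ] n ∈ P

IsMax : Pred ℕ 0ℓ → ℕ → Set
IsMax P m = m ∈ P × (∀ n → n ∈ P → n ≤ m)

{-# OPTIONS --safe #-}

-- A bb-free word has at most one more b than a's, and conversely every such pair
-- of letter counts is realised by a word ba⋯ba a⋯a or ba⋯ba b.  So, with p = S(a) and
-- q = S(b), the image of S is the set of n > 0 of the form i p + j q with j ≤ i + 1.
-- As p and q are coprime, every n is i p + j q with i ∈ ℤ and 0 ≤ j < p; if it is not in
-- the image then i ≤ j − 2, so n ≤ p (j − 2) + q j ≤ p (p − 3) + q (p − 1).  This bound is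
-- itself not attained: it is congruent to −q modulo p, which forces p ∣ j + 1, hence
-- j ≥ p − 1 and i ≥ p − 2.
module Submission where

open import Defs
open import Data.Irrelevant using () renaming ([_] to irr)
open import Data.List using (List; []; _∷_; map; filter; upTo)
open import Data.List.Membership.Propositional.Properties using (∈-filter⁺; ∈-filter⁻; ∈-upTo⁺)
open import Data.List.NonEmpty using (toList) renaming (_∷_ to _∷⁺_)
open import Data.List.Relation.Binary.Infix.Heterogeneous using (Infix; here; there)
open import Data.List.Relation.Binary.Prefix.Heterogeneous using ([]; _∷_)
open import Data.Nat using (ℕ; zero; suc; _≤_; _<_; z≤n; s≤s; _≤?_; _<?_; NonZero; >-nonZero)
open import Data.Nat.Coprimality using (Coprime; coprime-Bézout; coprime-divisor; gcd≡1⇒coprime)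
open import Data.Nat.Divisibility using (_∣_; divides; n∣m*n; ∣m+n∣m⇒∣n; ∣⇒≤)
open import Data.Nat.DivMod using (_/_; _%_; m≡m%n+[m/n]*n; m%n<n)
open import Data.Nat.GCD using (gcd; module Bézout)
open import Data.Nat.ListAction using (sum)
open import Data.Nat.Properties
open import Data.Product using (∃-syntax; _×_; _,_; proj₂)
open import Data.Refinement using (value; _,_)
open import Function.Bundles using (mk⇔)
open import Relation.Binary.PropositionalEquality using (_≡_; refl; sym; trans; cong; cong₂; subst; module ≡-Reasoning)
open import Relation.Nullary using (¬_; contradiction; recompute)
open import Relation.Nullary.Decidable using (map′; ¬?; _×-dec_; decidable-stable)
open import Relation.Unary using (Pred; Decidable; _∈_; _∖_)

module _ where
  open import Data.Nat using (_+_; _*_; _∸_)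
  open import Data.Nat.Tactic.RingSolver using (solve-∀)

  -- Numbers `i * p + j * q` with `j ≤ suc i`

  Representable : ℕ → ℕ → ℕ → Set
  Representable p q n = ∃[ i ] ∃[ j ] (j ≤ suc i × i * p + j * q ≡ n)

  -- Positive `p` and `q` force `i ≤ n` and `j ≤ n`, so a bounded search decides. Decidability is
  -- what later allows the gaps to be listed.
  representable? : ∀ p q .{{_ : NonZero p}} .{{_ : NonZero q}} → Decidable (Representable p q)
  representable? p q n = map′ forget bound
    (anyUpTo? (λ i → anyUpTo? (λ j → (j ≤? suc i) ×-dec (i * p + j * q ≟ n)) (suc n)) (suc n))
    where
    forget : ∃[ i ] (i < suc n × (∃[ j ] (j < suc n × j ≤ suc i × i * p + j * q ≡ n))) →
             Representable p q n
    forget (i , _ , j , _ , j≤ , eq) = i , j , j≤ , eq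

    bound : Representable p q n →
            ∃[ i ] (i < suc n × (∃[ j ] (j < suc n × j ≤ suc i × i * p + j * q ≡ n)))
    bound (i , j , j≤ , refl) =
      i , s≤s (≤-trans (m≤m*n i p) (m≤m+n (i * p) (j * q))) ,
      j , s≤s (≤-trans (m≤m*n j q) (m≤n+m (j * q) (i * p))) , j≤ , refl

  -- The equation i p + j q = n with i = t − s, written without subtraction.
  ReducedSolution : ℕ → ℕ → ℕ → Set
  ReducedSolution p q n = ∃[ j ] ∃[ s ] ∃[ t ] (j < p × n + s * p ≡ j * q + t * p)

  -- Passing from `j` to its remainder modulo `p` moves `j / p` copies of `p * q` from the multiples
  -- of `q` to those of `p`.
  reduce : ∀ {p q n} .{{_ : NonZero p}} j s t → n + s * p ≡ j * q + t * p → ReducedSolution p q n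
  reduce {p} {q} {n} j s t eq = j % p , s , j / p * q + t , m%n<n j p , (begin
    n + s * p                          ≡⟨ eq ⟩
    j * q + t * p                      ≡⟨ cong (λ k → k * q + t * p) (m≡m%n+[m/n]*n j p) ⟩
    (j % p + j / p * p) * q + t * p    ≡⟨ regroup (j % p) (j / p) p q t ⟩
    j % p * q + (j / p * q + t) * p    ∎)
    where
    open ≡-Reasoning
    regroup : ∀ r d p q t → (r + d * p) * q + t * p ≡ r * q + (d * q + t) * p
    regroup = solve-∀

  -- A Bézout identity scaled by `n` solves the equation for some `j`, which `reduce` brings below
  -- `p`.
  coprime⇒reducedSolution : ∀ {p q} .{{_ : NonZero p}} → Coprime p q → ∀ n → ReducedSolution p q n
  coprime⇒reducedSolution {p@(suc p′)} {q} p⊥q n with coprime-Bézout p⊥q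
  ... | Bézout.-+ x y eq = reduce (n * y) (n * x) 0 (begin
          n + n * x * p      ≡⟨ factor n x p ⟩
          n * (1 + x * p)    ≡⟨ cong (n *_) eq ⟩
          n * (y * q)        ≡⟨ expand n y q p ⟩
          n * y * q + 0 * p  ∎)
    where
    open ≡-Reasoning
    factor : ∀ n x p → n + n * x * p ≡ n * (1 + x * p)
    factor = solve-∀
    expand : ∀ n y q p → n * (y * q) ≡ n * y * q + 0 * p
    expand = solve-∀
  -- Here −y is the inverse of q modulo p, and −y ≡ (p − 1) y.
  ... | Bézout.+- x y eq = reduce (n * y * p′) (n * y * q) (n * x) (begin
          n + n * y * q * (1 + p′)             ≡⟨ factor n y q p′ ⟩
          n * y * p′ * q + n * (1 + y * q)     ≡⟨ cong (λ k → n * y * p′ * q + n * k) eq ⟩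
          n * y * p′ * q + n * (x * p)         ≡⟨ cong (n * y * p′ * q +_) (*-assoc n x p) ⟨
          n * y * p′ * q + n * x * p           ∎)
    where
    open ≡-Reasoning
    factor : ∀ n y q p′ → n + n * y * q * (1 + p′) ≡ n * y * p′ * q + n * (1 + y * q)
    factor = solve-∀

  -- m = p (p − 3) + q (p − 1), with the negative terms moved to the left.
  IsFrobenius : ℕ → ℕ → ℕ → Set
  IsFrobenius p q m = m + (3 * p + q) ≡ p * p + q * p

  -- For `p = 2` the value is `q - 2`, and coprimality excludes `q = 2`. For `p = 3 + k` no factor
  -- is negative and the term in `q` is positive.
  frobenius : ∀ {p q} → Coprime p q → 1 < p → 1 < q → ∃[ m ] (0 < m × IsFrobenius p q m)
  frobenius {1} _ (s≤s ()) _
  frobenius {_} {1} _ _ (s≤s ())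
  frobenius {2} {2} 2⊥2 _ _ = contradiction (2⊥2 (divides 1 refl , divides 1 refl)) λ ()
  frobenius {2} {suc (suc (suc k))} _ _ _ = 1 + k , s≤s z≤n , identity k
    where
    identity : ∀ k → 1 + k + (6 + (3 + k)) ≡ 4 + (3 + k) * 2
    identity = solve-∀
  frobenius {suc (suc (suc k))} {q@(suc (suc _))} _ _ _ =
    (3 + k) * k + q * (2 + k) ,
    ≤-trans (s≤s z≤n) (m≤n+m (q * (2 + k)) ((3 + k) * k)) ,
    identity k q
    where
    identity : ∀ k q → (3 + k) * k + q * (2 + k) + (3 * (3 + k) + q) ≡ (3 + k) * (3 + k) + q * (3 + k)
    identity = solve-∀

  frobenius-unrepresentable : ∀ {p q m} → Coprime p q → 0 < p → IsFrobenius p q m →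
                              ¬ Representable p q m
  frobenius-unrepresentable {p} {q} p⊥q 0<p m-frob (i , j , j≤1+i , refl) =
    <-irrefl refl (begin-strict
      p * p + q * p                    <⟨ m<n+m (p * p + q * p) 0<p ⟩
      p + (p * p + q * p)              ≡⟨ regroup p q ⟩
      -- `p ≤ 1 + j` together with `j ≤ 1 + i` gives `1 + p ≤ 3 + i`.
      (1 + p) * p + p * q              ≤⟨ +-mono-≤ (*-monoˡ-≤ p (s≤s (≤-trans p≤1+j (s≤s j≤1+i)))) (*-monoˡ-≤ q p≤1+j) ⟩
      (3 + i) * p + (1 + j) * q        ≡⟨ total ⟩
      p * p + q * p                    ∎)
    where
    open ≤-Reasoning
    regroup : ∀ p q → p + (p * p + q * p) ≡ (1 + p) * p + p * q
    regroup = solve-∀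
    collect : ∀ i j p q → (3 + i) * p + (1 + j) * q ≡ i * p + j * q + (3 * p + q)
    collect = solve-∀
    total : (3 + i) * p + (1 + j) * q ≡ p * p + q * p
    total = trans (collect i j p q) m-frob
    p∣[1+j]q : p ∣ (1 + j) * q
    p∣[1+j]q = ∣m+n∣m⇒∣n (divides (p + q) (trans total (sym (*-distribʳ-+ p p q)))) (n∣m*n (3 + i))
    p≤1+j : p ≤ 1 + j
    p≤1+j = ∣⇒≤ (coprime-divisor p⊥q (subst (p ∣_) (*-comm (1 + j) q) p∣[1+j]q))

  -- With `i = t - s`, the condition `j ≤ i + 1` reads `s + j ≤ suc t`. Its failure would give
  -- `n ≤ m`.
  above-frobenius-representable : ∀ {p q m n} .{{_ : NonZero p}} → Coprime p q →
                                  IsFrobenius p q m → m < n → Representable p q n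
  above-frobenius-representable {p} {q} {m} {n} p⊥q m-frob m<n
    with coprime⇒reducedSolution p⊥q n
  ... | j , s , t , j<p , eq = t ∸ s , j , j≤1+[t∸s] , +-cancelʳ-≡ (s * p) _ n (begin-equality
    (t ∸ s) * p + j * q + s * p  ≡⟨ regroup (t ∸ s) p j q s ⟩
    j * q + (t ∸ s + s) * p      ≡⟨ cong (λ k → j * q + k * p) (m∸n+n≡m s≤t) ⟩
    j * q + t * p                ≡⟨ eq ⟨
    n + s * p                    ∎)
    where
    open ≤-Reasoning
    regroup : ∀ d p j q s → d * p + j * q + s * p ≡ j * q + (d + s) * p
    regroup = solve-∀

    n≤m : ¬ (s + j ≤ suc t) → n ≤ m
    n≤m s+j≰1+t = +-cancelʳ-≤ (3 * p + q + s * p) n m (begin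
      n + (3 * p + q + s * p)              ≡⟨ shift n s p q ⟩
      (n + s * p) + (3 * p + q)            ≡⟨ cong (_+ (3 * p + q)) eq ⟩
      j * q + t * p + (3 * p + q)          ≡⟨ collect j q t p ⟩
      -- The negated inequality means `2 + t ≤ s + j`; `j < p` is used here as `1 + j ≤ p`, and once
      -- more below.
      (1 + j) * q + (1 + (2 + t)) * p      ≤⟨ +-mono-≤ (*-monoˡ-≤ q j<p) (*-monoˡ-≤ p (s≤s (≰⇒> s+j≰1+t))) ⟩
      p * q + (1 + (s + j)) * p            ≡⟨ split p q s j ⟩
      p * q + s * p + (1 + j) * p          ≤⟨ +-monoʳ-≤ (p * q + s * p) (*-monoˡ-≤ p j<p) ⟩
      p * q + s * p + p * p                ≡⟨ merge p q s ⟩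
      p * p + q * p + s * p                ≡⟨ cong (_+ s * p) m-frob ⟨
      m + (3 * p + q) + s * p              ≡⟨ +-assoc m (3 * p + q) (s * p) ⟩
      m + (3 * p + q + s * p)              ∎)
      where
      shift : ∀ n s p q → n + (3 * p + q + s * p) ≡ (n + s * p) + (3 * p + q)
      shift = solve-∀
      collect : ∀ j q t p → j * q + t * p + (3 * p + q) ≡ (1 + j) * q + (1 + (2 + t)) * p
      collect = solve-∀
      split : ∀ p q s j → p * q + (1 + (s + j)) * p ≡ p * q + s * p + (1 + j) * p
      split = solve-∀
      merge : ∀ p q s → p * q + s * p + p * p ≡ p * p + q * p + s * p
      merge = solve-∀

    s+j≤1+t : s + j ≤ suc t
    s+j≤1+t = decidable-stable (s + j ≤? suc t) λ s+j≰1+t → <⇒≱ m<n (n≤m s+j≰1+t)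

    s≤t-by-cases : ∀ j → s + j ≤ suc t → n + s * p ≡ j * q + t * p → s ≤ t
    -- For `j = 0` the inequality yields only `s ≤ suc t`, so the equation, now `n + s * p ≡ t * p`,
    -- is used instead.
    s≤t-by-cases zero _ eq = *-cancelʳ-≤ s t p (≤-trans (m≤n+m (s * p) n) (≤-reflexive eq))
    s≤t-by-cases (suc j) le _ =
      ≤-trans (m≤m+n s j) (≤-pred (≤-trans (≤-reflexive (sym (+-suc s j))) le))

    s≤t : s ≤ t
    s≤t = s≤t-by-cases j s+j≤1+t eq

    j≤1+[t∸s] : j ≤ suc (t ∸ s)
    j≤1+[t∸s] = +-cancelˡ-≤ s j (suc (t ∸ s)) (begin
      s + j              ≤⟨ s+j≤1+t ⟩
      suc t              ≡⟨ cong suc (m+[n∸m]≡n s≤t) ⟨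
      suc (s + (t ∸ s))  ≡⟨ +-suc s (t ∸ s) ⟨
      s + suc (t ∸ s)    ∎)

  -- Letter counts of bb-free words

  #a #b : List Letter → ℕ
  #a []      = 0
  #a (a ∷ w) = suc (#a w)
  #a (b ∷ w) = #a w
  #b []      = 0
  #b (a ∷ w) = #b w
  #b (b ∷ w) = suc (#b w)

  sum-by-counts : ∀ (f : Letter → ℕ) w → sum (map f w) ≡ #a w * f a + #b w * f b
  sum-by-counts f []      = refl
  sum-by-counts f (a ∷ w) =
    trans (cong (f a +_) (sum-by-counts f w)) (sym (+-assoc (f a) (#a w * f a) (#b w * f b)))
  sum-by-counts f (b ∷ w) =
    trans (cong (f b +_) (sum-by-counts f w)) (swap (f b) (#a w * f a) (#b w * f b))
    where
    swap : ∀ x y z → x + (y + z) ≡ y + (x + z)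
    swap = solve-∀

  BBFree : Pred (List Letter) _
  BBFree w = ¬ Infix _≡_ (b ∷ b ∷ []) w

  -- Every `b` except possibly a final one is followed by an `a`, and these pairs `ba` are disjoint.
  BBFree⇒#b≤1+#a : ∀ w → BBFree w → #b w ≤ suc (#a w)
  BBFree⇒#b≤1+#a []          _    = z≤n
  BBFree⇒#b≤1+#a (a ∷ w)     free = m≤n⇒m≤1+n (BBFree⇒#b≤1+#a w (λ bb → free (there bb)))
  BBFree⇒#b≤1+#a (b ∷ [])    _    = s≤s z≤n
  BBFree⇒#b≤1+#a (b ∷ a ∷ w) free = s≤s (BBFree⇒#b≤1+#a w (λ bb → free (there (there bb))))
  BBFree⇒#b≤1+#a (b ∷ b ∷ w) free = contradiction (here (refl ∷ refl ∷ [])) free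

  BBFreeWithCounts : ℕ → ℕ → Set
  BBFreeWithCounts i j = ∃[ w ] (BBFree w × #a w ≡ i × #b w ≡ j)

  -- Prepending `ba` raises both counts by one, and its `a` keeps a new `bb` from arising. The
  -- recursion ends in a run of `a` or in a single `b`.
  bbFreeWithCounts : ∀ i j → j ≤ suc i → BBFreeWithCounts i j
  bbFreeWithCounts zero    zero          _         = [] , (λ { (here ()) }) , refl , refl
  bbFreeWithCounts (suc i) zero          _         with bbFreeWithCounts i zero z≤n
  ... | w , free , refl , #b≡0 = a ∷ w , (λ { (here (() ∷ _)) ; (there bb) → free bb }) , refl , #b≡0
  bbFreeWithCounts zero    (suc zero)    _         = b ∷ [] , letter∈GM b , refl , refl
  bbFreeWithCounts zero    (suc (suc _)) (s≤s ())
  bbFreeWithCounts (suc i) (suc j)       (s≤s j≤1+i) with bbFreeWithCounts i j j≤1+i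
  ... | w , free , refl , refl = b ∷ a ∷ w , free′ , refl , refl
    where
    free′ : BBFree (b ∷ a ∷ w)
    free′ (here (_ ∷ () ∷ _))
    free′ (there (here (() ∷ _)))
    free′ (there (there bb)) = free bb

  -- The image of a homomorphism and its gaps

  module _ (S : Homomorphism) where
    open Homomorphism S

    ⟦⟧-by-counts : ∀ w → ⟦ w ⟧ ≡ #a (toList (value w)) * ⟦ letter a ⟧ + #b (toList (value w)) * ⟦ letter b ⟧
    ⟦⟧-by-counts w = trans (homo w) (sum-by-counts (λ x → ⟦ letter x ⟧) (toList (value w)))

    image⇒representable : ∀ {n} → Image S n → Representable ⟦ letter a ⟧ ⟦ letter b ⟧ n
    image⇒representable (w@(v , irr free) , eq) =
      #a (toList v) , #b (toList v) ,
      -- The proof `free` is irrelevant, but `≤` is decidable, so the inequality can be recovered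
      -- from it.
      recompute (_ ≤? _) (BBFree⇒#b≤1+#a (toList v) free) ,
      trans (sym (⟦⟧-by-counts w)) eq

    representable⇒image : ∀ {n} → 0 < n → Representable ⟦ letter a ⟧ ⟦ letter b ⟧ n → Image S n
    representable⇒image 0<n (i , j , j≤1+i , eq) with bbFreeWithCounts i j j≤1+i
    -- Zero counts give the empty word, which is not in the language; then `n` would be zero.
    ... | []    , _    , refl , refl = contradiction eq (<⇒≢ 0<n)
    ... | x ∷ v , free , refl , refl = w , trans (⟦⟧-by-counts w) eq
      where
      w : 𝓛-GM
      w = (x ∷⁺ v) , irr free

    gap? : Decidable (ℕ⁺ ∖ Image S)
    gap? n = map′
      (λ (0<n , ¬rep) → 0<n , λ im → ¬rep (image⇒representable im))
      (λ (0<n , ¬im) → 0<n , λ rep → ¬im (representable⇒image 0<n rep))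
      ((0 <? n) ×-dec ¬? (representable? _ _ {{>-nonZero (positive (letter a))}} {{>-nonZero (positive (letter b))}} n))

    frobenius-isMax : ∀ {m} → Coprime ⟦ letter a ⟧ ⟦ letter b ⟧ → 0 < m →
                      IsFrobenius ⟦ letter a ⟧ ⟦ letter b ⟧ m → IsMax (ℕ⁺ ∖ Image S) m
    frobenius-isMax {m} a⊥b 0<m m-frob =
      (0<m , λ im → frobenius-unrepresentable a⊥b (positive (letter a)) m-frob (image⇒representable im)) ,
      λ n (0<n , ¬im) → ≮⇒≥ λ m<n → ¬im (representable⇒image 0<n
        (above-frobenius-representable {{>-nonZero (positive (letter a))}} a⊥b m-frob m<n))

bounded⇒finite : ∀ {P : Pred ℕ _} {m} → Decidable P → (∀ n → n ∈ P → n ≤ m) → Finite P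
bounded⇒finite {m = m} P? bound = filter P? (upTo (suc m)) , λ n →
  mk⇔ (λ n∈ → proj₂ (∈-filter⁻ P? {xs = upTo (suc m)} n∈))
      (λ Pn → ∈-filter⁺ P? (∈-upTo⁺ (s≤s (bound n Pn))) Pn)

-- The closed formula over the integers

open import Data.Integer using (+_; _+_; _-_; _*_)
open import Data.Integer.Properties using (pos-*)
open import Data.Integer.Tactic.RingSolver using (solve-∀)

-- The factor `p - 3` is negative at `p = 2`, where truncated subtraction would give a wrong value;
-- hence the passage to integers.
IsFrobenius⇒ℤ-formula : ∀ p q {m} → IsFrobenius p q m →
                        + m ≡ + p * (+ p - + 3) + + q * (+ p - + 1)
IsFrobenius⇒ℤ-formula p q {m} m-frob = begin
  + m                                                          ≡⟨ add-sub (+ m) (+ p) (+ q) ⟩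
  + m + (+ 3 * + p + + q) - (+ 3 * + p + + q)                  ≡⟨ cong (_- (+ 3 * + p + + q)) cast ⟩
  + p * + p + + q * + p - (+ 3 * + p + + q)                    ≡⟨ factor (+ p) (+ q) ⟩
  + p * (+ p - + 3) + + q * (+ p - + 1)                        ∎
  where
  open ≡-Reasoning
  import Data.Nat as ℕ
  add-sub : ∀ m p q → m ≡ m + (+ 3 * p + q) - (+ 3 * p + q)
  add-sub = solve-∀
  factor : ∀ p q → p * p + q * p - (+ 3 * p + q) ≡ p * (p - + 3) + q * (p - + 1)
  factor = solve-∀
  cast : + m + (+ 3 * + p + + q) ≡ + p * + p + + q * + p
  cast = begin
    + m + (+ 3 * + p + + q)          ≡⟨ cong (λ k → + m + (k + + q)) (pos-* 3 p) ⟨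
    + (m ℕ.+ (3 ℕ.* p ℕ.+ q))        ≡⟨ cong +_ m-frob ⟩
    + (p ℕ.* p) + + (q ℕ.* p)        ≡⟨ cong₂ _+_ (pos-* p p) (pos-* q p) ⟩
    + p * + p + + q * + p            ∎

theorem1 : (S : Homomorphism) →
    let open Homomorphism S
        Sa = ⟦ letter a ⟧
        Sb = ⟦ letter b ⟧
    in gcd Sa Sb ≡ 1 → 1 < Sa → 1 < Sb →
       Finite (ℕ⁺ ∖ Image S) ×
       Nonempty (ℕ⁺ ∖ Image S) ×
       (∃[ m ] (IsMax (ℕ⁺ ∖ Image S) m ×
                + m ≡ + Sa * (+ Sa - + 3) + + Sb * (+ Sa - + 1)))
theorem1 S gcd≡1 1<Sa 1<Sb with gcd≡1⇒coprime gcd≡1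
... | a⊥b with frobenius a⊥b 1<Sa 1<Sb
... | m , 0<m , m-frob with frobenius-isMax S a⊥b 0<m m-frob
... | isMax@(m-gap , m-bound) =
  bounded⇒finite (gap? S) m-bound , (m , m-gap) , m , isMax ,
  IsFrobenius⇒ℤ-formula (⟦ letter a ⟧) (⟦ letter b ⟧) m-frob
  where open Homomorphism S
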